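{- The zero forcing number of the generalized gear graph $Gr(m,r)$ is $\mathrm{Z}\big(Gr(m,r)\big) = 3$.
   Context: The generalized gear graph, denoted $Gr(m,r)$, is the (undirected) graph with vertex set $\{v_i\}_{i=0}^{m(r+1)}$ such that for distinct vertices $v_i, v_j$, the edge $v_iv_j$ is present if and only if (for some ordering of the two indices) one of the following is true: (1) $i=0$ and $(r+1) \mid j$; (2) $i,j \neq 0$ and $|i-j|=1$; (3) $\{i,j\} = \{1, m(r+1)\}$. The definition is given with no explicit range for the parameters $m$ and $r$. In the special case $r=1$ this is the traditional gear graph. Zero forcing: each vertex of a graph $G$ is initially colored blue or white. Color change rule: if $u$ is blue and $v$ is the only white neighbor of $u$, then $u$ can force $v$ to become blue; blue vertices stay blue. A set $B \subseteq V(G)$ is a zero forcing set of $G$ if, starting with exactly the vertices of $B$ blue, repeated application of the rule eventually makes every vertex of $G$ blue. The zero forcing number $\mathrm{Z}(G)$ is the minimum cardinality among the zero forcing sets of $G$.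
   Formalization: The parameters are restricted to m ≥ 2 and m(r+1) ≥ 3; in the excluded cases (m = 0, m = 1, and the triangle Gr(2,0)) the zero forcing number is less than 3, so the claim without a range is false there. -}

module Defs where

open import Data.Nat using (ℕ; suc; _*_; _≤_; ∣_-_∣)
open import Data.Nat.Divisibility using (_∣_)
open import Data.Fin using (Fin; toℕ)
open import Data.Fin.Subset using (Subset; _∈_; _∉_; _∪_; ⁅_⁆; ⊤; ∣_∣)
open import Data.Product using (_×_; _,_; ∃-syntax; ∃₂)
open import Data.Sum using (_⊎_; swap)
open import Function using (_∘_)
open import Relation.Binary.Construct.Closure.ReflexiveTransitive using (Star)
open import Relation.Binary.Definitions using (Symmetric; Irreflexive)
open import Relation.Binary.PropositionalEquality using (_≡_; _≢_; sym)

record Graph (n : ℕ) : Set₁ where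
  field
    Adj    : Fin n → Fin n → Set
    symm   : Symmetric Adj
    irrefl : Irreflexive _≡_ Adj

module _ {n : ℕ} (G : Graph n) where
  open Graph G

  -- A colouring is identified with its set B of blue vertices.
  CanForce : Subset n → Fin n → Fin n → Set
  CanForce B u v =
    u ∈ B × Adj u v × v ∉ B × (∀ w → Adj u w → w ∉ B → w ≡ v)

  Step : Subset n → Subset n → Set
  Step B B′ = ∃₂ λ u v → CanForce B u v × B′ ≡ B ∪ ⁅ v ⁆

  IsZeroForcingSet : Subset n → Set
  IsZeroForcingSet B = Star Step B ⊤

  -- Z(G) = k, stated as a relation between G and k.
  ZeroForcingNumberIs : ℕ → Set
  ZeroForcingNumberIs k =
    (∃[ B ] (IsZeroForcingSet B × ∣ B ∣ ≡ k)) ×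
    (∀ B → IsZeroForcingSet B → k ≤ ∣ B ∣)

-- The edge condition for one ordering of the two indices: a spoke at the hub
-- v₀, consecutive rim vertices, or the edge closing up the rim.
GearEdge : (m r : ℕ) → ℕ → ℕ → Set
GearEdge m r i j =
  (i ≡ 0 × suc r ∣ j)
  ⊎ (i ≢ 0 × j ≢ 0 × ∣ i - j ∣ ≡ 1)
  ⊎ (i ≡ 1 × j ≡ m * suc r)

-- The index of a vertex is its value as a natural number. Distinctness is
-- needed because suc r divides 0, and 1 may equal m * suc r.
-- Degenerate parameters are allowed here: if m ≤ 1 there is at most one spoke,
-- and Gr 2 0 is a triangle; in exactly these cases the zero forcing number is
-- less than 3.
Gr : (m r : ℕ) → Graph (suc (m * suc r))
Gr m r = record
  { Adj    = λ x y → x ≢ y ×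
               (GearEdge m r (toℕ x) (toℕ y) ⊎ GearEdge m r (toℕ y) (toℕ x))
  ; symm   = λ (x≢y , e) → x≢y ∘ sym , swap e
  ; irrefl = λ x≡y (x≢y , _) → x≢y x≡y
  }

{-# OPTIONS --safe #-}

-- Upper bound: the hub together with rim vertices 1, …, k (k ≥ 2) has k + 1 as
-- the only white neighbour of k, so {0, 1, 2} forces its way around the rim.
--
-- Lower bound: a fort is a nonempty set F such that no vertex outside F has
-- exactly one neighbour in F; a set disjoint from a fort never forces into it.
-- Any two vertices a, b are avoided by some fort. If they are not adjacent, the
-- complement of {a, b} works, since all degrees are at least 2. If they are the
-- hub and a spoke end, the vertices whose index is not a multiple of r + 1 work
-- (for r = 0, the complement of {a, b}). If they are adjacent on the rim, they
-- lie on a closed rim arc between consecutive spoke ends, whose complement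
-- works: each end of the arc sees the hub and one rim vertex outside the arc,
-- and the inner vertices see nothing outside.

module Submission where

open import Defs
open import Data.Nat using (ℕ; zero; suc; _+_; _*_; _∸_; _/_; _≤_; _<_; z≤n; s≤s; s≤s⁻¹; z<s; _≟_; _<?_; ∣_-_∣; _≤′_; ≤′-refl; ≤′-step; >-nonZero)
open import Data.Nat.Properties
open import Data.Nat.DivMod using (m≡m%n+[m/n]*n; m%n<n; m/n*n≤m)
open import Data.Nat.Divisibility using (_∣_; _∤_; _∣?_; _∣0; ∣-refl; ∣1⇒≡1; 1∣_; >⇒∤; ∣m+n∣m⇒∣n; ∣m∣n⇒∣m+n; n∣m*n)
open import Data.Fin using (Fin; toℕ; fromℕ<; zero; suc)
open import Data.Fin.Properties using (toℕ-fromℕ<; toℕ-injective; toℕ≤pred[n])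
open import Data.Fin.Subset using (Subset; inside; outside; _∈_; _∉_; _∪_; ⁅_⁆; ⊤; ∣_∣) renaming (_-_ to _∖_)
open import Data.Fin.Subset.Properties using (∈⊤; Empty-unique; ∣⊥∣≡0; nonempty?; ∣p─q∣≤∣p∣; x∈p∪q⁻; x∈⁅y⁆⇒x≡y; x∈p⇒∣p-x∣<∣p∣; x∈p∧x≢y⇒x∈p-y; ∪-identityʳ)
import Data.Fin.Properties as Fin
open import Data.Product using (_×_; _,_; ∃-syntax; ∃₂)
open import Data.Sum using (_⊎_; inj₁; inj₂; swap; [_,_]′)
open import Data.Vec using ([]; _∷_; here; there)
open import Function using (_∘_)
open import Relation.Binary.Construct.Closure.ReflexiveTransitive using (Star; ε; _◅_; _◅◅_)
open import Relation.Binary.Definitions using (tri<; tri≈; tri>)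
open import Relation.Binary.PropositionalEquality using (_≡_; _≢_; refl; sym; trans; cong; subst)
open import Relation.Nullary using (¬_; Dec; yes; no; contradiction)
open import Relation.Nullary.Decidable using (decidable-stable; ¬?; _×-dec_; _⊎-dec_)

-- Initial segments and subsets of at most two elements.

initial : ∀ n → ℕ → Subset n
initial zero    _       = []
initial (suc n) zero    = outside ∷ initial n zero
initial (suc n) (suc k) = inside ∷ initial n k

∣initial∣ : ∀ {n k} → k ≤ n → ∣ initial n k ∣ ≡ k
∣initial∣ {zero}  z≤n     = refl
∣initial∣ {suc n} z≤n     = ∣initial∣ {n} z≤n
∣initial∣         (s≤s p) = cong suc (∣initial∣ p)

initial-full : ∀ n → initial n n ≡ ⊤
initial-full zero    = refl
initial-full (suc n) = cong (inside ∷_) (initial-full n)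

∈initial⁺ : ∀ {n k} {x : Fin n} → toℕ x < k → x ∈ initial n k
∈initial⁺ {suc n} {suc k} {zero}  _ = here
∈initial⁺ {suc n} {suc k} {suc x} p = there (∈initial⁺ (s≤s⁻¹ p))

∈initial⁻ : ∀ {n k} {x : Fin n} → x ∈ initial n k → toℕ x < k
∈initial⁻ {suc n} {zero}  {suc x} (there p) = contradiction (∈initial⁻ p) λ ()
∈initial⁻ {suc n} {suc k} {zero}  _         = z<s
∈initial⁻ {suc n} {suc k} {suc x} (there p) = s≤s (∈initial⁻ p)

initial-suc : ∀ {n} (x : Fin n) →
              initial n (suc (toℕ x)) ≡ initial n (toℕ x) ∪ ⁅ x ⁆
initial-suc {suc n} zero    = cong (inside ∷_) (sym (∪-identityʳ (initial n zero)))
initial-suc {suc n} (suc x) = cong (inside ∷_) (initial-suc x)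

remove-one : ∀ {n k} (B : Subset (suc n)) → ∣ B ∣ ≤ suc k → ∃[ a ] ∣ B ∖ a ∣ ≤ k
remove-one {n} B ∣B∣≤1+k with nonempty? B
... | yes (a , a∈B) = a , s≤s⁻¹ (≤-trans (x∈p⇒∣p-x∣<∣p∣ a∈B) ∣B∣≤1+k)
-- `zero` is an arbitrary default: there is nothing to remove.
... | no  B-empty   = zero , ≤-trans (∣p─q∣≤∣p∣ B ⁅ zero ⁆) (≤-trans (≤-reflexive ∣B∣≡0) z≤n)
  where
  ∣B∣≡0 : ∣ B ∣ ≡ 0
  ∣B∣≡0 = trans (cong ∣_∣ (Empty-unique B-empty)) (∣⊥∣≡0 (suc n))

-- `a` and `b` may coincide or lie outside `B`, so sets with fewer than two elements need no
-- separate treatment.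
two-cover : ∀ {n} (B : Subset (suc n)) → ∣ B ∣ ≤ 2 →
            ∃₂ λ a b → ∀ {x} → x ∈ B → x ≡ a ⊎ x ≡ b
two-cover B ∣B∣≤2 with remove-one B ∣B∣≤2
... | a , ∣B-a∣≤1 with remove-one (B ∖ a) ∣B-a∣≤1
... | b , ∣B-a-b∣≤0 = a , b , covered
  where
  covered : ∀ {x} → x ∈ B → x ≡ a ⊎ x ≡ b
  covered {x} x∈B with x Fin.≟ a | x Fin.≟ b
  ... | yes x≡a | _       = inj₁ x≡a
  ... | no  _   | yes x≡b = inj₂ x≡b
  ... | no  x≢a | no  x≢b = contradiction
    (≤-trans (x∈p⇒∣p-x∣<∣p∣ (x∈p∧x≢y⇒x∈p-y (x∈p∧x≢y⇒x∈p-y x∈B x≢a) x≢b)) ∣B-a-b∣≤0)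
    λ ()

-- Forts in an arbitrary graph.

module _ {n : ℕ} (G : Graph n) where
  open Graph G

  Fort : (Fin n → Set) → Set
  Fort F = ∀ {u v} → ¬ F u → F v → Adj u v → ∃[ w ] (w ≢ v × Adj u w × F w)

  -- A blue `u` forcing some `v` in `F` would lie outside `F` and so have a second neighbour in `F`.
  -- That one is white too, so `v` is not the only white neighbour.
  fort-blocks : ∀ {F} → Fort F → ∀ {B B′} → Star (Step G) B B′ →
                (∀ {x} → x ∈ B → ¬ F x) → ∀ {x} → x ∈ B′ → ¬ F x
  fort-blocks         fort ε avoids = avoids
  fort-blocks {F = F} fort {B} ((u , v , (u∈B , u~v , _ , unique) , refl) ◅ steps) avoids =
    fort-blocks fort steps λ x∈B∪v →
      [ avoids , (λ x∈v → subst (¬_ ∘ F) (sym (x∈⁅y⁆⇒x≡y v x∈v)) ¬Fv) ]′ (x∈p∪q⁻ B ⁅ v ⁆ x∈B∪v)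
    where
    ¬Fv : ¬ F v
    ¬Fv Fv with fort (avoids u∈B) Fv u~v
    ... | w , w≢v , u~w , Fw = w≢v (unique w u~w λ w∈B → avoids w∈B Fw)

-- Arithmetic of vertex indices.

∣n-[1+n]∣≡1 : ∀ n → ∣ n - suc n ∣ ≡ 1
∣n-[1+n]∣≡1 zero    = refl
∣n-[1+n]∣≡1 (suc n) = ∣n-[1+n]∣≡1 n

∣i-j∣≡1⇒consecutive : ∀ i j → ∣ i - j ∣ ≡ 1 → j ≡ suc i ⊎ i ≡ suc j
∣i-j∣≡1⇒consecutive zero    _       eq = inj₁ eq
∣i-j∣≡1⇒consecutive (suc i) zero    eq = inj₂ eq
∣i-j∣≡1⇒consecutive (suc i) (suc j) eq with ∣i-j∣≡1⇒consecutive i j eq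
... | inj₁ p = inj₁ (cong suc p)
... | inj₂ p = inj₂ (cong suc p)

-- Otherwise `s` would divide `u ∸ l`, which is positive and less than `s`.
∤-between : ∀ {s l u} → s ∣ l → l < u → u < s + l → s ∤ u
∤-between {s} {l} {u} s∣l l<u u<s+l s∣u =
  >⇒∤ {{>-nonZero (m<n⇒0<n∸m l<u)}} u∸l<s
    (∣m+n∣m⇒∣n (subst (s ∣_) (sym l+[u∸l]≡u) s∣u) s∣l)
  where
  l+[u∸l]≡u : l + (u ∸ l) ≡ u
  l+[u∸l]≡u = m+[n∸m]≡n (<⇒≤ l<u)
  u∸l<s : u ∸ l < s
  u∸l<s = +-cancelˡ-< l _ _
    (subst (_< l + s) (sym l+[u∸l]≡u) (subst (u <_) (+-comm s l) u<s+l))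

-- The gear graph with vertices taken as natural numbers at most M.
module _ (m r : ℕ) (2≤m : 2 ≤ m) (3≤M : 3 ≤ m * suc r) where

  private
    s M : ℕ
    s = suc r
    M = m * suc r

  E : ℕ → ℕ → Set
  E i j = i ≢ j × (GearEdge m r i j ⊎ GearEdge m r j i)

  E-sym : ∀ {i j} → E i j → E j i
  E-sym (i≢j , e) = i≢j ∘ sym , swap e

  E? : ∀ i j → Dec (E i j)
  E? i j = ¬? (i ≟ j) ×-dec (gearEdge? i j ⊎-dec gearEdge? j i)
    where
    gearEdge? : ∀ i j → Dec (GearEdge m r i j)
    gearEdge? i j =
      (i ≟ 0 ×-dec (s ∣? j)) ⊎-dec
      ((¬? (i ≟ 0) ×-dec (¬? (j ≟ 0) ×-dec (∣ i - j ∣ ≟ 1))) ⊎-dec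
       (i ≟ 1 ×-dec j ≟ M))

  E-spoke : ∀ {j} → s ∣ j → j ≢ 0 → E 0 j
  E-spoke s∣j j≢0 = j≢0 ∘ sym , inj₁ (inj₁ (refl , s∣j))

  E-next : ∀ {i} → i ≢ 0 → E i (suc i)
  E-next {i} i≢0 = m≢1+m+n i ∘ (λ e → trans e (cong suc (sym (+-identityʳ i)))) ,
    inj₁ (inj₂ (inj₁ (i≢0 , (λ ()) , ∣n-[1+n]∣≡1 i)))

  E-close : E 1 M
  E-close = <⇒≢ (≤-trans (s≤s (s≤s z≤n)) 3≤M) , inj₁ (inj₂ (inj₂ (refl , refl)))

  data RimNeighbour (u : ℕ) : ℕ → Set where
    hub   : s ∣ u → RimNeighbour u 0
    next  : RimNeighbour u (suc u)
    -- The condition `v ≢ 0` leaves the hub to the constructor `hub`: vertex `1` need not be a spoke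
    -- end.
    prev  : ∀ {v} → v ≢ 0 → u ≡ suc v → RimNeighbour u v
    last  : u ≡ 1 → RimNeighbour u M
    first : u ≡ M → RimNeighbour u 1

  rimNeighbour : ∀ {u v} → u ≢ 0 → E u v → RimNeighbour u v
  rimNeighbour u≢0 (_ , inj₁ (inj₁ (u≡0 , _))) = contradiction u≡0 u≢0
  rimNeighbour {u} {v} _ (_ , inj₁ (inj₂ (inj₁ (_ , v≢0 , d)))) with ∣i-j∣≡1⇒consecutive u v d
  ... | inj₁ refl = next
  ... | inj₂ eq   = prev v≢0 eq
  rimNeighbour _ (_ , inj₁ (inj₂ (inj₂ (u≡1 , refl)))) = last u≡1
  rimNeighbour _ (_ , inj₂ (inj₁ (refl , s∣u))) = hub s∣u
  rimNeighbour {u} {v} _ (_ , inj₂ (inj₂ (inj₁ (v≢0 , _ , d)))) with ∣i-j∣≡1⇒consecutive v u d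
  ... | inj₁ eq   = prev v≢0 eq
  ... | inj₂ refl = next
  rimNeighbour _ (_ , inj₂ (inj₂ (inj₂ (refl , u≡M)))) = first u≡M

  s∣M : s ∣ M
  s∣M = n∣m*n m

  M≢0 : M ≢ 0
  M≢0 M≡0 = contradiction (subst (3 ≤_) M≡0 3≤M) λ ()

  hubNeighbour : ∀ {v} → E 0 v → s ∣ v
  hubNeighbour (_ , inj₁ (inj₁ (_ , s∣v)))               = s∣v
  hubNeighbour (_ , inj₁ (inj₂ (inj₁ (0≢0 , _))))         = contradiction refl 0≢0
  hubNeighbour (0≢v , inj₂ (inj₁ (v≡0 , _)))              = contradiction (sym v≡0) 0≢v
  hubNeighbour (_ , inj₂ (inj₂ (inj₁ (_ , 0≢0 , _))))     = contradiction refl 0≢0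
  hubNeighbour (_ , inj₂ (inj₂ (inj₂ (_ , 0≡M))))         = contradiction (sym 0≡M) M≢0

  -- For `r = 0` this is `3 ≤ M` itself; otherwise `s ≥ 2` and `m ≥ 2` give `M ≥ 2 * s ≥ s + 2`. It
  -- leaves a rim vertex strictly between `s` and `M`.
  1+s<M : suc s < M
  1+s<M = go 2≤m 3≤M
    where
    go : ∀ {m r} → 2 ≤ m → 3 ≤ m * suc r → 2 + r < m * suc r
    go {r = zero}                      _             3≤M = 3≤M
    go {m = suc (suc m)} {r = suc r} (s≤s (s≤s _)) _   =
      s≤s (s≤s (≤-trans (≤-reflexive (+-comm 2 r)) (+-monoʳ-≤ r (s≤s (s≤s z≤n)))))

  s<M : s < M
  s<M = <-trans (n<1+n s) 1+s<M

  -- Of two distinct witnesses, one differs from any given neighbour, as `Fort` demands. The bounds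
  -- are explicit because `E` also relates numbers beyond `M`, such as `M` and `suc M`.
  TwoIn : (ℕ → Set) → ℕ → Set
  TwoIn F u = ∃₂ λ p q → p ≢ q × (p ≤ M × E u p × F p) × (q ≤ M × E u q × F q)

  TwoIn-map : ∀ {F F′ u} → (∀ {p} → E u p → F p → F′ p) → TwoIn F u → TwoIn F′ u
  TwoIn-map f (p , q , p≢q , (p≤M , u~p , Fp) , (q≤M , u~q , Fq)) =
    p , q , p≢q , (p≤M , u~p , f u~p Fp) , (q≤M , u~q , f u~q Fq)

  -- These are the two neighbours along the rim, with the closing edge used at `1` and at `M`. They
  -- differ because the rim has at least three vertices.
  two-on-rim : ∀ {u} → u ≢ 0 → u ≤ M → TwoIn (_≢ 0) u
  two-on-rim {zero}        u≢0 _   = contradiction refl u≢0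
  two-on-rim {suc zero}    u≢0 _   =
    2 , M , <⇒≢ 3≤M , (<⇒≤ 3≤M , E-next u≢0 , λ ()) , (≤-refl , E-close , M≢0)
  two-on-rim {suc (suc k)} u≢0 u≤M with suc (suc k) ≟ M
  ... | no  u≢M =
    suc k , suc (suc (suc k)) , (λ ()) ,
    (<⇒≤ u≤M , E-sym (E-next λ ()) , λ ()) , (≤∧≢⇒< u≤M u≢M , E-next u≢0 , λ ())
  ... | yes u≡M =
    suc k , 1 , (λ eq → <⇒≢ 3≤M (trans (cong suc (sym eq)) u≡M)) ,
    (<⇒≤ u≤M , E-sym (E-next λ ()) , λ ()) ,
    (≤-trans (s≤s z≤n) 3≤M , subst (λ v → E v 1) (sym u≡M) (E-sym E-close) , λ ())

  two-neighbours : ∀ {u} → u ≤ M → TwoIn (λ v → E u v) u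
  two-neighbours {u} u≤M with u ≟ 0
  ... | no  u≢0  = TwoIn-map (λ u~p _ → u~p) (two-on-rim u≢0 u≤M)
  ... | yes refl =
    -- The first and the last spoke end, distinct because there are at least two spokes.
    s , M , <⇒≢ s<M , (<⇒≤ s<M , e , e) , (≤-refl , e′ , e′)
    where
    e  = E-spoke ∣-refl λ ()
    e′ = E-spoke s∣M M≢0

  -- Forts avoiding two given vertices.

  record Separator (a b : ℕ) : Set₁ where
    field
      F        : ℕ → Set
      outside₁ : ¬ F a
      outside₂ : ¬ F b
      member   : ∃[ x ] (x ≤ M × F x)
      -- "Not exactly one neighbour in `F`" becomes a choice between at least two and none, made
      -- from `u` alone.
      fort     : ∀ {u} → u ≤ M → ¬ F u → TwoIn F u ⊎ (∀ {v} → E u v → ¬ F v)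

  Separator-sym : ∀ {a b} → Separator a b → Separator b a
  Separator-sym S = record { Separator S ; outside₁ = outside₂ ; outside₂ = outside₁ }
    where open Separator S

  -- Only `a` and `b` lie outside this set, so the fort condition has to be checked at these two
  -- alone.
  complement-separator : ∀ {a b} → a ≤ M →
    TwoIn (λ x → x ≢ a × x ≢ b) a → TwoIn (λ x → x ≢ a × x ≢ b) b → Separator a b
  complement-separator {a} {b} a≤M two-a@(p , _ , _ , (p≤M , _ , Fp) , _) two-b = record
    { F        = λ x → x ≢ a × x ≢ b
    ; outside₁ = λ (a≢a , _) → a≢a refl
    ; outside₂ = λ (_ , b≢b) → b≢b refl
    ; member   = p , p≤M , Fp
    ; fort     = λ {u} _ ¬Fu → inj₁ (fort u ¬Fu)
    }
    where
    fort : ∀ u → ¬ (u ≢ a × u ≢ b) → TwoIn (λ x → x ≢ a × x ≢ b) u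
    fort u ¬Fu with u ≟ a | u ≟ b
    ... | yes refl | _        = two-a
    ... | no  _    | yes refl = two-b
    ... | no  u≢a  | no  u≢b  = contradiction (u≢a , u≢b) ¬Fu

  -- The neighbours of either vertex avoid both vertices. The case `a ≡ b` is included, since `E` is
  -- irreflexive.
  nonadjacent-separator : ∀ {a b} → a ≤ M → b ≤ M → ¬ E a b → Separator a b
  nonadjacent-separator a≤M b≤M a≁b = complement-separator a≤M
    (TwoIn-map (λ (a≢p , _) a~p → a≢p ∘ sym , λ { refl → a≁b a~p }) (two-neighbours a≤M))
    (TwoIn-map (λ (b≢p , _) b~p → (λ { refl → a≁b (E-sym b~p) }) , b≢p ∘ sym) (two-neighbours b≤M))

  -- For `s > 1` the hub sees multiples of `s` only, while both rim neighbours of a spoke end are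
  -- non-multiples.
  spoke-separator : ∀ {j} → j ≢ 0 → j ≤ M → s ∣ j → Separator 0 j
  spoke-separator {j} j≢0 j≤M s∣j with s ≟ 1
  -- For `s = 1` there are no non-multiples. Every rim vertex is a spoke end, so the rim neighbours
  -- of `j` serve for the hub as well.
  ... | yes s≡1 = complement-separator z≤n (from-hub (two-on-rim j≢0 j≤M))
                    (TwoIn-map (λ (j≢p , _) p≢0 → p≢0 , j≢p ∘ sym) (two-on-rim j≢0 j≤M))
    where
    from-hub : TwoIn (_≢ 0) j → TwoIn (λ x → x ≢ 0 × x ≢ j) 0
    from-hub (p , q , p≢q , (p≤M , (j≢p , _) , p≢0) , (q≤M , (j≢q , _) , q≢0)) =
      p , q , p≢q ,
      (p≤M , E-spoke (subst (_∣ p) (sym s≡1) (1∣ p)) p≢0 , p≢0 , j≢p ∘ sym) ,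
      (q≤M , E-spoke (subst (_∣ q) (sym s≡1) (1∣ q)) q≢0 , q≢0 , j≢q ∘ sym)
  ... | no  s≢1 = record
    { F        = s ∤_
    ; outside₁ = λ s∤0 → s∤0 (s ∣0)
    ; outside₂ = λ s∤j → s∤j s∣j
    ; member   = 1 , ≤-trans (s≤s z≤n) 3≤M , s∤1
    ; fort     = λ {u} u≤M ¬s∤u → fort u≤M (decidable-stable (s ∣? u) ¬s∤u)
    }
    where
    s∤1 : s ∤ 1
    s∤1 = s≢1 ∘ ∣1⇒≡1

    consecutive : ∀ {k} → s ∣ k → s ∤ suc k
    consecutive {k} s∣k s∣1+k = s∤1 (∣m+n∣m⇒∣n (subst (s ∣_) (+-comm 1 k) s∣1+k) s∣k)

    off-spokes : ∀ {u p} → u ≢ 0 → s ∣ u → E u p → p ≢ 0 → s ∤ p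
    off-spokes u≢0 s∣u u~p p≢0 s∣p with rimNeighbour u≢0 u~p
    ... | hub _       = p≢0 refl
    ... | next        = consecutive s∣u s∣p
    ... | prev _ refl = consecutive s∣p s∣u
    ... | last refl   = s∤1 s∣u
    ... | first _     = s∤1 s∣p

    fort : ∀ {u} → u ≤ M → s ∣ u → TwoIn (s ∤_) u ⊎ (∀ {v} → E u v → ¬ (s ∤ v))
    fort {u} u≤M s∣u with u ≟ 0
    ... | yes refl = inj₂ λ 0~v s∤v → s∤v (hubNeighbour 0~v)
    ... | no  u≢0  = inj₁ (TwoIn-map (off-spokes u≢0 s∣u) (two-on-rim u≢0 u≤M))

  arc-separator : ∀ {l a b} → s ∣ l → l ≢ 0 → s + l ≤ M →
                  l ≤ a → a ≤ s + l → l ≤ b → b ≤ s + l → Separator a b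
  arc-separator {l} {a} {b} s∣l l≢0 s+l≤M l≤a a≤s+l l≤b b≤s+l = record
    { F        = F
    ; outside₁ = inside-arc l≤a a≤s+l
    ; outside₂ = inside-arc l≤b b≤s+l
    ; member   = 0 , z≤n , inj₁ 0<l
    ; fort     = fort
    }
    where
    -- The hub falls under `x < l`, as `l` is positive.
    F : ℕ → Set
    F x = x < l ⊎ s + l < x

    0<l : 0 < l
    0<l = n≢0⇒n>0 l≢0

    inside-arc : ∀ {x} → l ≤ x → x ≤ s + l → ¬ F x
    inside-arc l≤x _     (inj₁ x<l)   = <⇒≱ x<l l≤x
    inside-arc _   x≤s+l (inj₂ s+l<x) = <⇒≱ s+l<x x≤s+l

    s+1<M : s + 1 < M
    s+1<M = subst (_< M) (+-comm 1 s) 1+s<M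

    rim-pred : ∀ n → n ≢ 0 → n ≢ 1 → ∃[ k ] (k ≢ 0 × n ≡ suc k)
    rim-pred zero          n≢0 _   = contradiction refl n≢0
    rim-pred (suc zero)    _   n≢1 = contradiction refl n≢1
    rim-pred (suc (suc k)) _   _   = suc k , (λ ()) , refl

    left-end : TwoIn F l
    left-end with l ≟ 1
    -- Before `1` the rim continues at `M`, which the arc from `1` to `s + 1` does not reach.
    ... | yes refl = 0 , M , M≢0 ∘ sym ,
      (z≤n , E-sym (E-spoke s∣l l≢0) , inj₁ 0<l) , (≤-refl , E-close , inj₂ s+1<M)
    ... | no  l≢1 with rim-pred l l≢0 l≢1
    ...   | k , k≢0 , refl = 0 , k , k≢0 ∘ sym ,
      (z≤n , E-sym (E-spoke s∣l l≢0) , inj₁ 0<l) ,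
      (≤-trans (n≤1+n k) (≤-trans (m≤n+m l s) s+l≤M) , E-sym (E-next k≢0) , inj₁ ≤-refl)

    right-hub : E (s + l) 0
    right-hub = E-sym (E-spoke (∣m∣n⇒∣m+n ∣-refl s∣l) λ ())

    right-end : TwoIn F (s + l)
    right-end with s + l ≟ M
    ... | no  s+l≢M = 0 , suc (s + l) , (λ ()) , (z≤n , right-hub , inj₁ 0<l) ,
      (≤∧≢⇒< s+l≤M s+l≢M , E-next (λ ()) , inj₂ ≤-refl)
    -- After `M` the rim continues at `1`; it is outside the arc, as `l = 1` would give `s + 1 = M`.
    ... | yes s+l≡M = 0 , 1 , (λ ()) , (z≤n , right-hub , inj₁ 0<l) ,
      (≤-trans (s≤s z≤n) 3≤M , subst (λ v → E v 1) (sym s+l≡M) (E-sym E-close) ,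
       inj₁ (≤∧≢⇒< 0<l λ { refl → <⇒≢ s+1<M s+l≡M }))

    inner : ∀ {u v} → l < u → u < s + l → E u v → ¬ F v
    inner {u} l<u u<s+l u~v with rimNeighbour (λ { refl → n≮0 l<u }) u~v
    ... | hub s∣u      = λ _ → ∤-between s∣l l<u u<s+l s∣u
    ... | next         = inside-arc (<⇒≤ (m<n⇒m<1+n l<u)) u<s+l
    ... | prev _ refl  = inside-arc (s≤s⁻¹ l<u) (<⇒≤ (<-trans (n<1+n _) u<s+l))
    ... | last refl    = contradiction l<u (≤⇒≯ 0<l)
    ... | first refl   = contradiction u<s+l (≤⇒≯ s+l≤M)

    fort : ∀ {u} → u ≤ M → ¬ F u → TwoIn F u ⊎ (∀ {v} → E u v → ¬ F v)
    fort {u} u≤M ¬Fu with <-cmp u l | <-cmp u (s + l)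
    ... | tri< u<l _ _  | _              = contradiction (inj₁ u<l) ¬Fu
    ... | tri≈ _ refl _ | _              = inj₁ left-end
    ... | tri> _ _ _    | tri≈ _ refl _  = inj₁ right-end
    ... | tri> _ _ _    | tri> _ _ s+l<u = contradiction (inj₂ s+l<u) ¬Fu
    ... | tri> _ _ l<u  | tri< u<s+l _ _ = inj₂ (inner l<u u<s+l)

  -- The arc at the seam of the numbering: it runs from M through 1 to s.
  SeamArc : ℕ → Set
  SeamArc x = (x ≢ 0 × x ≤ s) ⊎ x ≡ M

  -- The counterpart of `arc-separator` for `l = 0`: the index `0` belongs to the hub, so the lower
  -- end of the arc is `M`.
  seam-separator : ∀ {a b} → SeamArc a → SeamArc b → Separator a b
  seam-separator arc-a arc-b = record
    { F        = F
    ; outside₁ = inside-arc arc-a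
    ; outside₂ = inside-arc arc-b
    ; member   = 0 , z≤n , inj₁ refl
    ; fort     = fort
    }
    where
    F : ℕ → Set
    F x = x ≡ 0 ⊎ (s < x × x < M)

    inside-arc : ∀ {x} → SeamArc x → ¬ F x
    inside-arc (inj₁ (x≢0 , _)) (inj₁ x≡0)       = x≢0 x≡0
    inside-arc (inj₁ (_ , x≤s)) (inj₂ (s<x , _)) = <⇒≱ s<x x≤s
    inside-arc (inj₂ refl)      (inj₁ M≡0)       = M≢0 M≡0
    inside-arc (inj₂ refl)      (inj₂ (_ , M<M)) = <-irrefl refl M<M

    s-end : TwoIn F s
    s-end = 0 , suc s , (λ ()) ,
      (z≤n , E-sym (E-spoke ∣-refl λ ()) , inj₁ refl) ,
      (s<M , E-next (λ ()) , inj₂ (≤-refl , 1+s<M))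

    -- Stated for a variable `n` so that matching yields the predecessor of `M`.
    M-end : ∀ {n} → n ≡ M → TwoIn F n
    M-end {zero}  0≡M = contradiction (sym 0≡M) M≢0
    M-end {suc k} k+1≡M = 0 , k , <⇒≢ 0<k ,
      (z≤n , subst (λ n → E n 0) (sym k+1≡M) (E-sym (E-spoke s∣M M≢0)) , inj₁ refl) ,
      (<⇒≤ k<M , E-sym (E-next (>⇒≢ 0<k)) , inj₂ (s<k , k<M))
      where
      s<k : s < k
      s<k = s≤s⁻¹ (subst (suc s <_) (sym k+1≡M) 1+s<M)
      0<k : 0 < k
      0<k = ≤-trans (s≤s z≤n) s<k
      k<M : k < M
      k<M = ≤-reflexive k+1≡M

    inner : ∀ {u v} → u ≢ 0 → u < s → E u v → ¬ F v
    inner {u} u≢0 u<s u~v with rimNeighbour u≢0 u~v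
    ... | hub s∣u       = λ _ →
      ∤-between (s ∣0) (n≢0⇒n>0 u≢0) (subst (u <_) (sym (+-identityʳ s)) u<s) s∣u
    ... | next          = inside-arc (inj₁ ((λ ()) , u<s))
    ... | prev v≢0 refl = inside-arc (inj₁ (v≢0 , <⇒≤ (<-trans (n<1+n _) u<s)))
    ... | last _        = inside-arc (inj₂ refl)
    ... | first _       = inside-arc (inj₁ ((λ ()) , s≤s z≤n))

    fort : ∀ {u} → u ≤ M → ¬ F u → TwoIn F u ⊎ (∀ {v} → E u v → ¬ F v)
    fort {u} u≤M ¬Fu with u ≟ M | <-cmp u s
    ... | yes refl | _              = inj₁ (M-end refl)
    ... | no  _    | tri≈ _ refl _  = inj₁ s-end
    ... | no  u≢M  | tri> _ _ s<u   = contradiction (inj₂ (s<u , ≤∧≢⇒< u≤M u≢M)) ¬Fu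
    ... | no  _    | tri< u<s _ _   = inj₂ (inner (¬Fu ∘ inj₁) u<s)

  -- The arc holding this edge starts at the largest multiple of `s` not above `k`. For `k < s` that
  -- multiple is `0`, which means the seam arc.
  rim-separator : ∀ {k} → k ≢ 0 → suc k ≤ M → Separator k (suc k)
  rim-separator {k} k≢0 k<M with k <? s
  ... | yes k<s = seam-separator (inj₁ (k≢0 , <⇒≤ k<s)) (inj₁ ((λ ()) , k<s))
  ... | no  k≮s = arc-separator (n∣m*n q) q*s≢0 s+q*s≤M
                    q*s≤k (<⇒≤ k<s+q*s) (m≤n⇒m≤1+n q*s≤k) k<s+q*s
    where
    q : ℕ
    q = k / s
    q*s≤k : q * s ≤ k
    q*s≤k = m/n*n≤m k s
    k<s+q*s : k < s + q * s
    k<s+q*s = subst (_< s + q * s) (sym (m≡m%n+[m/n]*n k s)) (+-monoˡ-< (q * s) (m%n<n k s))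
    q*s≢0 : q * s ≢ 0
    q*s≢0 q*s≡0 = k≮s (subst (k <_) (trans (cong (s +_) q*s≡0) (+-identityʳ s)) k<s+q*s)
    s+q*s≤M : s + q * s ≤ M
    -- From `q * s < m * s` follows `q < m`, so the next spoke end still has index at most `M`.
    s+q*s≤M = *-monoˡ-≤ s (*-cancelʳ-< s q m (≤-<-trans q*s≤k k<M))

  gearEdge-separator : ∀ {a b} → a ≤ M → b ≤ M → a ≢ b → GearEdge m r a b → Separator a b
  gearEdge-separator _ b≤M a≢b (inj₁ (refl , s∣b)) = spoke-separator (a≢b ∘ sym) b≤M s∣b
  gearEdge-separator {a} {b} a≤M b≤M _ (inj₂ (inj₁ (a≢0 , b≢0 , d))) with ∣i-j∣≡1⇒consecutive a b d
  ... | inj₁ refl = rim-separator a≢0 b≤M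
  ... | inj₂ refl = Separator-sym (rim-separator b≢0 a≤M)
  gearEdge-separator _ _ _ (inj₂ (inj₂ (refl , refl))) =
    seam-separator (inj₁ ((λ ()) , s≤s z≤n)) (inj₂ refl)

  separator : ∀ {a b} → a ≤ M → b ≤ M → Separator a b
  separator {a} {b} a≤M b≤M with E? a b
  ... | no  a≁b              = nonadjacent-separator a≤M b≤M a≁b
  ... | yes (a≢b , inj₁ e) = gearEdge-separator a≤M b≤M a≢b e
  ... | yes (a≢b , inj₂ e) = Separator-sym (gearEdge-separator b≤M a≤M (a≢b ∘ sym) e)

  -- Transfer to `Fin` and the lower bound.

  private
    G : Graph (suc M)
    G = Gr m r
    open Graph G using (Adj)

  ⟦_⟧ : ∀ {x} → x ≤ M → Fin (suc M)
  ⟦ x≤M ⟧ = fromℕ< (s≤s x≤M)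

  toℕ-⟦⟧ : ∀ {x} (x≤M : x ≤ M) → toℕ ⟦ x≤M ⟧ ≡ x
  toℕ-⟦⟧ x≤M = toℕ-fromℕ< (s≤s x≤M)

  Adj⇒E : ∀ {u v} → Adj u v → E (toℕ u) (toℕ v)
  Adj⇒E (u≢v , e) = u≢v ∘ toℕ-injective , e

  E⇒Adj : ∀ {u v} → E (toℕ u) (toℕ v) → Adj u v
  E⇒Adj (u≢v , e) = u≢v ∘ cong toℕ , e

  module _ {a b : ℕ} (S : Separator a b) where
    open Separator S

    lift : ∀ {u v w} → w ≤ M × E (toℕ u) w × F w → toℕ v ≢ w →
           ∃[ x ] (x ≢ v × Adj u x × F (toℕ x))
    lift {u} (w≤M , u~w , Fw) v≢w =
      ⟦ w≤M ⟧ , (λ { refl → v≢w (toℕ-⟦⟧ w≤M) }) ,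
      E⇒Adj (subst (E (toℕ u)) (sym (toℕ-⟦⟧ w≤M)) u~w) , subst F (sym (toℕ-⟦⟧ w≤M)) Fw

    separator-fort : Fort G (F ∘ toℕ)
    separator-fort {u} {v} ¬Fu Fv u~v with fort (toℕ≤pred[n] u) ¬Fu
    ... | inj₂ none = contradiction Fv (none (Adj⇒E u~v))
    ... | inj₁ (p , q , p≢q , white-p , white-q) with toℕ v ≟ p
    ...   | no  v≢p  = lift white-p v≢p
    ...   | yes refl = lift white-q p≢q

  -- Two vertices covering a smaller `B` are avoided by a fort, whose member could then never turn
  -- blue, although it lies in `⊤`.
  lower-bound : ∀ B → IsZeroForcingSet G B → 3 ≤ ∣ B ∣
  lower-bound B forcing = ≮⇒≥ (not-forcing ∘ s≤s⁻¹)
    where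
    not-forcing : ¬ (∣ B ∣ ≤ 2)
    not-forcing ∣B∣≤2 with two-cover B ∣B∣≤2
    ... | a , b , B⊆ab = blocked (separator (toℕ≤pred[n] a) (toℕ≤pred[n] b))
      where
      blocked : ¬ Separator (toℕ a) (toℕ b)
      blocked S with Separator.member S
      ... | x , x≤M , Fx =
        fort-blocks G (separator-fort S) forcing
          (λ y∈B → [ (λ { refl → outside₁ }) , (λ { refl → outside₂ }) ]′ (B⊆ab y∈B))
          (∈⊤ {x = ⟦ x≤M ⟧}) (subst F (sym (toℕ-⟦⟧ x≤M)) Fx)
        where open Separator S

  -- The upper bound: forcing around the rim.

  rim-step : ∀ {k} → 3 ≤ k → k ≤ M → Step G (initial (suc M) k) (initial (suc M) (suc k))
  rim-step {suc k} 3≤1+k 1+k≤M =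
    -- The blue vertices are `0` to `k`, and `k` forces `suc k`. Here `2 ≤ k` excludes vertex `1`,
    -- whose neighbour `M` may be white.
    u , v , (∈initial⁺ u<1+k , E⇒Adj u~v , v-white , only-v) , blue
    where
    k≤M = ≤-trans (n≤1+n k) 1+k≤M
    u = ⟦ k≤M ⟧
    v = ⟦ 1+k≤M ⟧
    toℕ-u : toℕ u ≡ k
    toℕ-u = toℕ-⟦⟧ k≤M
    toℕ-v : toℕ v ≡ suc k
    toℕ-v = toℕ-⟦⟧ 1+k≤M
    2≤k : 2 ≤ k
    2≤k = s≤s⁻¹ 3≤1+k
    k≢0 : k ≢ 0
    k≢0 refl = n≮0 2≤k
    u<1+k : toℕ u < suc k
    u<1+k = ≤-reflexive (cong suc toℕ-u)
    u~v : E (toℕ u) (toℕ v)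
    u~v rewrite toℕ-u | toℕ-v = E-next k≢0
    v-white : v ∉ initial (suc M) (suc k)
    v-white v∈ = <-irrefl toℕ-v (∈initial⁻ v∈)

    next-only : ∀ {w} → E k w → suc k ≤ w → w ≡ suc k
    next-only k~w k<w with rimNeighbour k≢0 k~w
    ... | next        = refl
    ... | hub _       = contradiction k<w n≮0
    ... | prev _ refl = contradiction k<w (≤⇒≯ (n≤1+n _))
    ... | last refl   = contradiction 2≤k λ { (s≤s ()) }
    ... | first refl  = contradiction 1+k≤M (<-irrefl refl)

    only-v : ∀ w → Adj u w → w ∉ initial (suc M) (suc k) → w ≡ v
    only-v w u~w w∉ = toℕ-injective (trans
      (next-only (subst (λ x → E x (toℕ w)) toℕ-u (Adj⇒E u~w)) (≮⇒≥ (w∉ ∘ ∈initial⁺)))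
      (sym toℕ-v))

    blue : initial (suc M) (suc (suc k)) ≡ initial (suc M) (suc k) ∪ ⁅ v ⁆
    blue = subst (λ x → initial (suc M) (suc x) ≡ initial (suc M) x ∪ ⁅ v ⁆) toℕ-v (initial-suc v)

  rim-steps : ∀ {k} → 3 ≤′ k → k ≤ suc M → Star (Step G) (initial (suc M) 3) (initial (suc M) k)
  rim-steps ≤′-refl          _      = ε
  rim-steps (≤′-step 3≤′k) 1+k≤1+M =
    rim-steps 3≤′k (<⇒≤ 1+k≤1+M) ◅◅ rim-step (≤′⇒≤ 3≤′k) (s≤s⁻¹ 1+k≤1+M) ◅ ε

  initial-forces : IsZeroForcingSet G (initial (suc M) 3)
  initial-forces = subst (Star (Step G) (initial (suc M) 3)) (initial-full (suc M))
    (rim-steps (≤⇒≤′ 3≤1+M) ≤-refl)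
    where
    3≤1+M : 3 ≤ suc M
    3≤1+M = m≤n⇒m≤1+n 3≤M

theorem2p3 : (m r : ℕ) → 2 ≤ m → 3 ≤ m * suc r → ZeroForcingNumberIs (Gr m r) 3
theorem2p3 m r 2≤m 3≤M =
  (initial (suc (m * suc r)) 3 , initial-forces m r 2≤m 3≤M , ∣initial∣ (m≤n⇒m≤1+n 3≤M)) ,
  lower-bound m r 2≤m 3≤M
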